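{- Let $\psi \in E(\mathcal{P})$ be a Boolean formula. If $\psi$ holds for the abstract system (i.e. $\langle\psi\rangle_{\sigma_{\mathcal{P}}}=\mathbf{true}$ for all $\sigma_{\mathcal{P}}\in R_A$), then the property $\forall\mathcal{X}\,\psi^{*}$ holds for the concrete system (i.e. $\forall\mathcal{X}\,\psi^{*}(s)$ holds for every $s\in R_C$).
   Context: **Logic.** Symbols are Boolean, integer, function (mapping integer tuples to integers) or predicate (mapping integer tuples to Booleans) symbols. CLU expressions are given by: Boolean expressions $b ::= \mathbf{true}\mid\mathbf{false}\mid$ Boolean symbol $\mid\neg b\mid b\wedge b\mid t=t\mid t<t\mid p(t,\dots,t)$; integer expressions $t ::=$ lambda-bound variable $\mid$ integer symbol $\mid \mathit{ITE}(b,t,t)$ (if-then-else) $\mid t+c$ ($c$ an integer constant) $\mid f(t,\dots,t)$; predicate expressions $p ::=$ predicate symbol $\mid\lambda x_1,\dots,x_k.\,b$; function expressions $f ::=$ function symbol $\mid \lambda x_1,\dots,x_k.\,t$ (lambda variables are integers). For a set of symbols $\mathcal{A}$, $E(\mathcal{A})$ is the set of CLU expressions over $\mathcal{A}$; $\Sigma_{\mathcal{A}}$ is the set of interpretations $\sigma_{\mathcal{A}}$, each assigning to every symbol of $\mathcal{A}$ a value of the appropriate type; $\langle\theta\rangle_{\sigma_{\mathcal{A}}}$ is the value of $\theta\in E(\mathcal{A})$ under $\sigma_{\mathcal{A}}$. For disjoint $\mathcal{A},\mathcal{B}$, $\sigma_{\mathcal{A}}\cdot\sigma_{\mathcal{B}}$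 is the combined interpretation of $\mathcal{A}\cup\mathcal{B}$. A named set $v$ over $\mathcal{A}$ of expressions over $\mathcal{B}$ has an expression $v_x\in E(\mathcal{B})$ of the type of $x$ for each $x\in\mathcal{A}$; $\langle v\rangle_{\sigma_{\mathcal{B}}}\in\Sigma_{\mathcal{A}}$ is the interpretation $x\mapsto\langle v_x\rangle_{\sigma_{\mathcal{B}}}$. $\theta[v/\mathcal{A}]$ is the result of simultaneously replacing each $x\in\mathcal{A}$ in $\theta$ by $v_x$. **Concrete system.** Pairwise disjoint symbol sets: state symbols $\mathcal{V}$, initial-state symbols $\mathcal{J}$, input symbols $\mathcal{I}$, index symbols $\mathcal{X}$, and a finite set $\mathcal{P}$ of Boolean predicate symbols. The system is given by expressions $q^0_x\in E(\mathcal{J})$ and $\delta_x\in E(\mathcal{V}\cup\mathcal{I})$ for each $x\in\mathcal{V}$. Concrete states are elements of $\Sigma_{\mathcal{V}}$; $Q^0_C=\{\langle q^0\rangle_{\sigma_{\mathcal{J}}}\mid\sigma_{\mathcal{J}}\in\Sigma_{\mathcal{J}}\}$; $N_C(s)=\{\langle\delta\rangle_{s\cdot\sigma_{\mathcal{I}}}\mid\sigma_{\mathcal{I}}\in\Sigma_{\mathcal{I}}\}$ and $N_C(S_C)=\bigcup_{s\in S_C}N_C(s)$. $R_C$ is the set of reachable states: those $s$ for which there is a sequence $s_0,\dots,s_n=s$ with $s_0\in Q^0_C$ and $s_{i+1}\in N_C(s_i)$ for $0\le i<n$. **Abstraction.** For each $p\in\mathcal{P}$ there is a Boolean expression $\phi_p\in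 E(\mathcal{V}\cup\mathcal{X})$; $\phi$ is the named set of these, so $\langle\phi\rangle_{s\cdot\sigma_{\mathcal{X}}}\in\Sigma_{\mathcal{P}}$. Abstract states are elements of $\Sigma_{\mathcal{P}}$. $\alpha(s)=\{\langle\phi\rangle_{s\cdot\sigma_{\mathcal{X}}}\mid\sigma_{\mathcal{X}}\in\Sigma_{\mathcal{X}}\}$, $\alpha(S_C)=\bigcup_{s\in S_C}\alpha(s)$, $\gamma(S_A)=\{s\mid\forall\sigma_{\mathcal{X}}\in\Sigma_{\mathcal{X}}:\langle\phi\rangle_{s\cdot\sigma_{\mathcal{X}}}\in S_A\}$. **Abstract reachability.** $Q^0_A=\alpha(Q^0_C)$, $N_A(S_A)=\alpha(N_C(\gamma(S_A)))$, $R_A^0=Q_A^0$, $R_A^{i+1}=R_A^i\cup N_A(R_A^i)$, and $R_A$ is the limit $R_A^n$ for $n$ with $R_A^n=R_A^{n+1}$ (which exists since $\Sigma_{\mathcal{P}}$ is finite). **Properties.** For a Boolean formula $\psi\in E(\mathcal{P})$, $\psi^{*}=\psi[\phi/\mathcal{P}]\in E(\mathcal{V}\cup\mathcal{X})$. For a concrete state $s$, $\forall\mathcal{X}\,\psi^{*}(s)$ holds when $\langle\psi^{*}\rangle_{s\cdot\sigma_{\mathcal{X}}}=\mathbf{true}$ for every $\sigma_{\mathcal{X}}\in\Sigma_{\mathcal{X}}$. -}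

module Defs where

open import Data.Bool.Base using (Bool; true; false; not; if_then_else_) renaming (_∧_ to _∧ᵇ_)
open import Data.Empty using (⊥)
open import Data.Fin.Base using (Fin; zero; suc; inject₁; fromℕ; lift)
open import Data.Integer.Base using (ℤ) renaming (_+_ to _+ℤ_)
open import Data.Integer.Properties using (_≟_; _<?_)
open import Data.Nat.Base using (ℕ; zero; suc; _+_)
open import Data.Product.Base using (_×_; ∃-syntax; Σ-syntax)
open import Data.Sum.Base using ([_,_])
open import Data.Vec.Base using (Vec; []; _∷_; _++_; lookup)
open import Function.Bundles using (_↔_)
open import Level using (0ℓ)
open import Relation.Binary.PropositionalEquality.Core using (_≡_)
open import Relation.Nullary.Decidable using (⌊_⌋)
open import Relation.Unary using (Pred; _∈_; _∪_; _≐_)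

data Type : Set where
  bool int  : Type
  fun  pred : ℕ → Type

Val : Type → Set
Val bool     = Bool
Val int      = ℤ
Val (fun k)  = Vec ℤ k → ℤ
Val (pred k) = Vec ℤ k → Bool

-- A set of symbols, given as the family of its symbols of each type.
-- The union of two disjoint symbol sets is then Relation.Unary's _∪_, which is
-- a disjoint sum at each type.
Symbols : Set₁
Symbols = Pred Type 0ℓ

booleans : Set → Symbols
booleans P bool = P
booleans P _    = ⊥

-- CLU expressions over 𝒜 with n integer lambda-bound variables in scope, as
-- de Bruijn indices. In the body of λ x₁,…,x_k the indices 0,…,k-1 are x₁,…,x_k
-- and the remaining ones are the variables of the enclosing scope.
data Expr (𝒜 : Symbols) (n : ℕ) : Type → Set where
  symbol  : ∀ {τ} → 𝒜 τ → Expr 𝒜 n τ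
  tt ff   : Expr 𝒜 n bool
  ¬′_     : Expr 𝒜 n bool → Expr 𝒜 n bool
  _∧′_    : Expr 𝒜 n bool → Expr 𝒜 n bool → Expr 𝒜 n bool
  _=′_    : Expr 𝒜 n int → Expr 𝒜 n int → Expr 𝒜 n bool
  _<′_    : Expr 𝒜 n int → Expr 𝒜 n int → Expr 𝒜 n bool
  papp    : ∀ {k} → Expr 𝒜 n (pred k) → Vec (Expr 𝒜 n int) k → Expr 𝒜 n bool
  var     : Fin n → Expr 𝒜 n int
  ITE     : Expr 𝒜 n bool → Expr 𝒜 n int → Expr 𝒜 n int → Expr 𝒜 n int
  _+′_    : Expr 𝒜 n int → ℤ → Expr 𝒜 n int
  fapp    : ∀ {k} → Expr 𝒜 n (fun k) → Vec (Expr 𝒜 n int) k → Expr 𝒜 n int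
  plam    : ∀ {k} → Expr 𝒜 (k + n) bool → Expr 𝒜 n (pred k)
  flam    : ∀ {k} → Expr 𝒜 (k + n) int → Expr 𝒜 n (fun k)

E : Symbols → Type → Set
E 𝒜 = Expr 𝒜 0

Interp : Symbols → Set
Interp 𝒜 = ∀ τ → 𝒜 τ → Val τ

-- Equality of values and of interpretations is extensional: function and
-- predicate values are compared pointwise, since propositional equality of
-- functions is not extensional here.
EqVal : ∀ τ → Val τ → Val τ → Set
EqVal bool     b c = b ≡ c
EqVal int      i j = i ≡ j
EqVal (fun k)  f g = ∀ is → f is ≡ g is
EqVal (pred k) p q = ∀ is → p is ≡ q is

infix 4 _≈_
_≈_ : ∀ {𝒜} → Interp 𝒜 → Interp 𝒜 → Set
_≈_ {𝒜} σ σ′ = ∀ τ (x : 𝒜 τ) → EqVal τ (σ τ x) (σ′ τ x)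

infixl 6 _·_
_·_ : ∀ {𝒜 ℬ} → Interp 𝒜 → Interp ℬ → Interp (𝒜 ∪ ℬ)
(σ · σ′) τ = [ σ τ , σ′ τ ]

mutual
  eval : ∀ {𝒜 n τ} → Expr 𝒜 n τ → Interp 𝒜 → Vec ℤ n → Val τ
  eval (symbol x)  σ ρ = σ _ x
  eval tt          σ ρ = true
  eval ff          σ ρ = false
  eval (¬′ b)      σ ρ = not (eval b σ ρ)
  eval (b ∧′ c)    σ ρ = eval b σ ρ ∧ᵇ eval c σ ρ
  eval (t =′ u)    σ ρ = ⌊ eval t σ ρ ≟ eval u σ ρ ⌋
  eval (t <′ u)    σ ρ = ⌊ eval t σ ρ <? eval u σ ρ ⌋
  eval (papp p ts) σ ρ = eval p σ ρ (evals ts σ ρ)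
  eval (var i)     σ ρ = lookup ρ i
  eval (ITE b t u) σ ρ = if eval b σ ρ then eval t σ ρ else eval u σ ρ
  eval (t +′ c)    σ ρ = eval t σ ρ +ℤ c
  eval (fapp f ts) σ ρ = eval f σ ρ (evals ts σ ρ)
  eval (plam b)    σ ρ = λ is → eval b σ (is ++ ρ)
  eval (flam t)    σ ρ = λ is → eval t σ (is ++ ρ)

  evals : ∀ {𝒜 n k} → Vec (Expr 𝒜 n int) k → Interp 𝒜 → Vec ℤ n → Vec ℤ k
  evals []       σ ρ = []
  evals (t ∷ ts) σ ρ = eval t σ ρ ∷ evals ts σ ρ

⟨_⟩ : ∀ {𝒜 τ} → E 𝒜 τ → Interp 𝒜 → Val τ
⟨ θ ⟩ σ = eval θ σ []

NamedSet : Symbols → Symbols → Set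
NamedSet 𝒜 ℬ = ∀ τ → 𝒜 τ → E ℬ τ

⟪_⟫ : ∀ {𝒜 ℬ} → NamedSet 𝒜 ℬ → Interp ℬ → Interp 𝒜
⟪ v ⟫ σ τ x = ⟨ v τ x ⟩ σ

mutual
  rename : ∀ {𝒜 m n τ} → (Fin m → Fin n) → Expr 𝒜 m τ → Expr 𝒜 n τ
  rename r (symbol x)   = symbol x
  rename r tt           = tt
  rename r ff           = ff
  rename r (¬′ b)       = ¬′ rename r b
  rename r (b ∧′ c)     = rename r b ∧′ rename r c
  rename r (t =′ u)     = rename r t =′ rename r u
  rename r (t <′ u)     = rename r t <′ rename r u
  rename r (papp p ts)  = papp (rename r p) (renames r ts)
  rename r (var i)      = var (r i)
  rename r (ITE b t u)  = ITE (rename r b) (rename r t) (rename r u)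
  rename r (t +′ c)     = rename r t +′ c
  rename r (fapp f ts)  = fapp (rename r f) (renames r ts)
  rename r (plam {k} b) = plam (rename (lift k r) b)
  rename r (flam {k} t) = flam (rename (lift k r) t)

  renames : ∀ {𝒜 m n k} → (Fin m → Fin n) → Vec (Expr 𝒜 m int) k → Vec (Expr 𝒜 n int) k
  renames r []       = []
  renames r (t ∷ ts) = rename r t ∷ renames r ts

-- The expressions v_x are closed, so substituting them under lambdas only needs
-- the weakening from the empty scope.
mutual
  subst : ∀ {𝒜 ℬ n τ} → NamedSet 𝒜 ℬ → Expr 𝒜 n τ → Expr ℬ n τ
  subst v (symbol x)  = rename (λ ()) (v _ x)
  subst v tt          = tt
  subst v ff          = ff
  subst v (¬′ b)      = ¬′ subst v b
  subst v (b ∧′ c)    = subst v b ∧′ subst v c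
  subst v (t =′ u)    = subst v t =′ subst v u
  subst v (t <′ u)    = subst v t <′ subst v u
  subst v (papp p ts) = papp (subst v p) (substs v ts)
  subst v (var i)     = var i
  subst v (ITE b t u) = ITE (subst v b) (subst v t) (subst v u)
  subst v (t +′ c)    = subst v t +′ c
  subst v (fapp f ts) = fapp (subst v f) (substs v ts)
  subst v (plam b)    = plam (subst v b)
  subst v (flam t)    = flam (subst v t)

  substs : ∀ {𝒜 ℬ n k} → NamedSet 𝒜 ℬ → Vec (Expr 𝒜 n int) k → Vec (Expr ℬ n int) k
  substs v []       = []
  substs v (t ∷ ts) = subst v t ∷ substs v ts

_[_] : ∀ {𝒜 ℬ τ} → E 𝒜 τ → NamedSet 𝒜 ℬ → E ℬ τ
θ [ v ] = subst v θ

record ConcreteSystem : Set₁ where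
  field
    𝒱 𝒥 ℐ : Symbols
    q⁰    : NamedSet 𝒱 𝒥
    δ     : NamedSet 𝒱 (𝒱 ∪ ℐ)

  State : Set
  State = Interp 𝒱

  Q⁰C : Pred State 0ℓ
  Q⁰C s = ∃[ σ ] s ≈ ⟪ q⁰ ⟫ σ

  NC : State → Pred State 0ℓ
  NC s s′ = ∃[ σ ] s′ ≈ ⟪ δ ⟫ (s · σ)

  NC* : Pred State 0ℓ → Pred State 0ℓ
  NC* S s′ = ∃[ s ] (s ∈ S × s′ ∈ NC s)

  RC : Pred State 0ℓ
  RC s = ∃[ n ] Σ[ r ∈ (Fin (suc n) → State) ]
           (r zero ∈ Q⁰C
          × (∀ (i : Fin n) → r (suc i) ∈ NC (r (inject₁ i)))
          × r (fromℕ n) ≈ s)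

record PredicateAbstraction (C : ConcreteSystem) : Set₁ where
  open ConcreteSystem C
  field
    𝒳        : Symbols
    P        : Set
    size     : ℕ
    P-finite : P ↔ Fin size
    φ        : NamedSet (booleans P) (𝒱 ∪ 𝒳)

  𝒫 : Symbols
  𝒫 = booleans P

  AbsState : Set
  AbsState = Interp 𝒫

  α : State → Pred AbsState 0ℓ
  α s a = ∃[ σ ] a ≈ ⟪ φ ⟫ (s · σ)

  α* : Pred State 0ℓ → Pred AbsState 0ℓ
  α* S a = ∃[ s ] (s ∈ S × a ∈ α s)

  -- Membership of ⟪ φ ⟫ (s · σ) in S is literal; every S of interest below (each
  -- R^i_A) is closed under _≈_.
  γ : Pred AbsState 0ℓ → Pred State 0ℓ
  γ S s = ∀ σ → ⟪ φ ⟫ (s · σ) ∈ S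

  Q⁰A : Pred AbsState 0ℓ
  Q⁰A = α* Q⁰C

  NA : Pred AbsState 0ℓ → Pred AbsState 0ℓ
  NA S = α* (NC* (γ S))

  RA^ : ℕ → Pred AbsState 0ℓ
  RA^ zero    = Q⁰A
  RA^ (suc i) = RA^ i ∪ NA (RA^ i)

  -- R^n_A for any n at which the sequence is stationary; all such n give the same
  -- set. Their existence follows from the finiteness of P, but only up to double
  -- negation, since membership in the sets R^i_A is not decidable.
  RA : Pred AbsState 0ℓ
  RA a = ∃[ n ] (RA^ n ≐ RA^ (suc n) × a ∈ RA^ n)

  _* : E 𝒫 bool → E (𝒱 ∪ 𝒳) bool
  ψ * = ψ [ φ ]

  ∀𝒳 : E (𝒱 ∪ 𝒳) bool → Pred State 0ℓ
  ∀𝒳 θ s = ∀ (σ : Interp 𝒳) → ⟨ θ ⟩ (s · σ) ≡ true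

{-# OPTIONS --safe #-}
module Submission where

-- The stationary iterate of the abstract reachability sequence is an inductive
-- invariant: its concretization contains every reachable concrete state. On such a
-- state ψ* evaluates, by the substitution lemma, to ψ at an abstract state of R_A.
-- Constructively the stationary iterate exists only up to double negation, which
-- suffices because the conclusion is an equation between Booleans.

open import Data.Bool.Base using (Bool; true; false; not; if_then_else_)
  renaming (_∧_ to _∧ᵇ_)
open import Data.Bool.Properties using (_≟_)
open import Data.Fin.Base using (Fin; zero; suc; inject₁; fromℕ; lift)
open import Data.Fin.Induction using (<-weakInduction)
open import Data.Integer.Base using (ℤ) renaming (_+_ to _+ℤ_)
import Data.Integer.Properties as ℤ
open import Data.Nat.Base using (ℕ; zero; suc; _≤_; _≤′_; _⊔_; ≤′-refl; ≤′-step; z≤n)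
open import Data.Nat.Properties using (≤⇒≤′; m≤m⊔n; m≤n⊔m)
open import Data.Product.Base using (_,_; ∃-syntax)
open import Data.Sum.Base using (inj₁; inj₂)
open import Data.Vec.Base using (Vec; []; _∷_; _++_; lookup; tabulate)
open import Data.Vec.Properties using (lookup∘tabulate)
open import Function.Base using (_∘_)
open import Function.Bundles using (Inverse)
open import Level using (0ℓ)
open import Relation.Binary.PropositionalEquality
  using (_≡_; refl; sym; trans; cong; cong₂)
open import Relation.Nullary.Decidable using (⌊_⌋; yes; no; decidable-stable; ¬¬-excluded-middle)
open import Relation.Nullary.Negation using (¬_; contradiction)
open import Relation.Unary using (Pred; _∈_; _⊆_; _≐_)
open import Defs

EqVal-refl : ∀ τ {x} → EqVal τ x x
EqVal-refl bool     = refl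
EqVal-refl int      = refl
EqVal-refl (fun k)  = λ _ → refl
EqVal-refl (pred k) = λ _ → refl

EqVal-sym : ∀ τ {x y} → EqVal τ x y → EqVal τ y x
EqVal-sym bool     p = sym p
EqVal-sym int      p = sym p
EqVal-sym (fun k)  p = sym ∘ p
EqVal-sym (pred k) p = sym ∘ p

EqVal-trans : ∀ τ {x y z} → EqVal τ x y → EqVal τ y z → EqVal τ x z
EqVal-trans bool     p q = trans p q
EqVal-trans int      p q = trans p q
EqVal-trans (fun k)  p q = λ is → trans (p is) (q is)
EqVal-trans (pred k) p q = λ is → trans (p is) (q is)

module _ {𝒜 : Symbols} where

  ≈-refl : {σ : Interp 𝒜} → σ ≈ σ
  ≈-refl τ x = EqVal-refl τ

  ≈-sym : {σ σ′ : Interp 𝒜} → σ ≈ σ′ → σ′ ≈ σ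
  ≈-sym p τ x = EqVal-sym τ (p τ x)

  ≈-trans : {σ σ′ σ″ : Interp 𝒜} → σ ≈ σ′ → σ′ ≈ σ″ → σ ≈ σ″
  ≈-trans p q τ x = EqVal-trans τ (p τ x) (q τ x)

if-cong : ∀ {A : Set} {b c : Bool} {x x′ y y′ : A} →
          b ≡ c → x ≡ x′ → y ≡ y′ → (if b then x else y) ≡ (if c then x′ else y′)
if-cong refl refl refl = refl

-- `EqVal` compares function and predicate values only pointwise, so the heads of two applications
-- need not be propositionally equal, while their argument vectors are.
app-cong : ∀ {A B : Set} {f g : A → B} {x y : A} → (∀ z → f z ≡ g z) → x ≡ y → f x ≡ g y
app-cong f≗g refl = f≗g _

-- Carries the hypothesis of `eval-rename` under a binder: `lift k r` fixes the `k` new indices,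
-- which both environments read off `is`.
lookup-lift : ∀ {m n} k {r : Fin m → Fin n} {ρ : Vec ℤ m} {ρ′ : Vec ℤ n} →
              (∀ i → lookup ρ′ (r i) ≡ lookup ρ i) →
              (is : Vec ℤ k) → ∀ i → lookup (is ++ ρ′) (lift k r i) ≡ lookup (is ++ ρ) i
lookup-lift zero    h []       i       = h i
lookup-lift (suc k) h (j ∷ is) zero    = refl
lookup-lift (suc k) h (j ∷ is) (suc i) = lookup-lift k h is i

module _ {𝒜 : Symbols} (σ : Interp 𝒜) where
  mutual
    -- Only weakening from the empty scope is used later, but below a lambda the renaming acts on a
    -- nonempty scope, so the induction needs arbitrary `r`.
    eval-rename : ∀ {m n τ} {r : Fin m → Fin n} {ρ : Vec ℤ m} {ρ′ : Vec ℤ n} →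
                  (∀ i → lookup ρ′ (r i) ≡ lookup ρ i) →
                  (e : Expr 𝒜 m τ) → EqVal τ (eval (rename r e) σ ρ′) (eval e σ ρ)
    eval-rename h (symbol {τ} x) = EqVal-refl τ
    eval-rename h tt          = refl
    eval-rename h ff          = refl
    eval-rename h (¬′ b)      = cong not (eval-rename h b)
    eval-rename h (b ∧′ c)    = cong₂ _∧ᵇ_ (eval-rename h b) (eval-rename h c)
    eval-rename h (t =′ u)    =
      cong₂ (λ x y → ⌊ x ℤ.≟ y ⌋) (eval-rename h t) (eval-rename h u)
    eval-rename h (t <′ u)    =
      cong₂ (λ x y → ⌊ x ℤ.<? y ⌋) (eval-rename h t) (eval-rename h u)
    eval-rename h (papp p ts) = app-cong (eval-rename h p) (evals-renames h ts)
    eval-rename h (var i)     = h i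
    eval-rename h (ITE b t u) =
      if-cong (eval-rename h b) (eval-rename h t) (eval-rename h u)
    eval-rename h (t +′ c)    = cong (_+ℤ c) (eval-rename h t)
    eval-rename h (fapp f ts) = app-cong (eval-rename h f) (evals-renames h ts)
    eval-rename h (plam b)    = λ is → eval-rename (lookup-lift _ h is) b
    eval-rename h (flam t)    = λ is → eval-rename (lookup-lift _ h is) t

    evals-renames : ∀ {m n k} {r : Fin m → Fin n} {ρ : Vec ℤ m} {ρ′ : Vec ℤ n} →
                    (∀ i → lookup ρ′ (r i) ≡ lookup ρ i) →
                    (ts : Vec (Expr 𝒜 m int) k) → evals (renames r ts) σ ρ′ ≡ evals ts σ ρ
    evals-renames h []       = refl
    evals-renames h (t ∷ ts) = cong₂ _∷_ (eval-rename h t) (evals-renames h ts)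

module _ {𝒜 ℬ : Symbols} (v : NamedSet 𝒜 ℬ) (σ : Interp ℬ) where
  mutual
    -- The environment `ρ` is arbitrary so that the induction passes under lambdas.
    eval-subst : ∀ {n τ} (e : Expr 𝒜 n τ) (ρ : Vec ℤ n) →
                 EqVal τ (eval (subst v e) σ ρ) (eval e (⟪ v ⟫ σ) ρ)
    -- `v _ x` is closed, so its value ignores `ρ`: the condition on environments ranges over
    -- `Fin 0`.
    eval-subst (symbol x)  ρ = eval-rename σ (λ ()) (v _ x)
    eval-subst tt          ρ = refl
    eval-subst ff          ρ = refl
    eval-subst (¬′ b)      ρ = cong not (eval-subst b ρ)
    eval-subst (b ∧′ c)    ρ = cong₂ _∧ᵇ_ (eval-subst b ρ) (eval-subst c ρ)
    eval-subst (t =′ u)    ρ =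
      cong₂ (λ x y → ⌊ x ℤ.≟ y ⌋) (eval-subst t ρ) (eval-subst u ρ)
    eval-subst (t <′ u)    ρ =
      cong₂ (λ x y → ⌊ x ℤ.<? y ⌋) (eval-subst t ρ) (eval-subst u ρ)
    eval-subst (papp p ts) ρ = app-cong (eval-subst p ρ) (evals-substs ts ρ)
    eval-subst (var i)     ρ = refl
    eval-subst (ITE b t u) ρ =
      if-cong (eval-subst b ρ) (eval-subst t ρ) (eval-subst u ρ)
    eval-subst (t +′ c)    ρ = cong (_+ℤ c) (eval-subst t ρ)
    eval-subst (fapp f ts) ρ = app-cong (eval-subst f ρ) (evals-substs ts ρ)
    eval-subst (plam b)    ρ = λ is → eval-subst b (is ++ ρ)
    eval-subst (flam t)    ρ = λ is → eval-subst t (is ++ ρ)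

    evals-substs : ∀ {n k} (ts : Vec (Expr 𝒜 n int) k) (ρ : Vec ℤ n) →
                   evals (substs v ts) σ ρ ≡ evals ts (⟪ v ⟫ σ) ρ
    evals-substs []       ρ = refl
    evals-substs (t ∷ ts) ρ = cong₂ _∷_ (eval-subst t ρ) (evals-substs ts ρ)

chain-mono : ∀ {A : Set} (S : ℕ → Pred A 0ℓ) → (∀ n → S n ⊆ S (suc n)) →
             ∀ {m n} → m ≤ n → S m ⊆ S n
chain-mono {A} S step = go ∘ ≤⇒≤′
  where
  go : ∀ {m n} → m ≤′ n → S m ⊆ S n
  go ≤′-refl       x∈ = x∈
  go (≤′-step m≤n) x∈ = step _ (go m≤n x∈)

-- Excluded middle for "x enters the chain at some stage" gives a bound for each
-- Boolean vector x; the finitely many bounds have a maximum.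
¬¬-chain-bound : ∀ k (S : ℕ → Pred (Vec Bool k) 0ℓ) → (∀ n → S n ⊆ S (suc n)) →
                 ¬ ¬ (∃[ N ] ∀ n → S n ⊆ S N)
¬¬-chain-bound zero S step ¬bound =
  ¬¬-excluded-middle {A = ∃[ n ] S n []} λ where
    (yes (n , []∈)) → ¬bound (n , λ { _ {[]} _ → []∈ })
    (no  []∉)       → ¬bound (0 , λ { n {[]} []∈ → contradiction (n , []∈) []∉ })
¬¬-chain-bound (suc k) S step ¬bound =
  ¬¬-chain-bound k (λ n v → S n (true ∷ v)) (λ n → step n) λ (M , ≤M) →
  ¬¬-chain-bound k (λ n v → S n (false ∷ v)) (λ n → step n) λ (N , ≤N) →
  ¬bound (M ⊔ N , λ where
    n {true  ∷ v} v∈ → chain-mono S step (m≤m⊔n M N) (≤M n v∈)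
    n {false ∷ v} v∈ → chain-mono S step (m≤n⊔m M N) (≤N n v∈))

module _ {C : ConcreteSystem} (A : PredicateAbstraction C) where
  open ConcreteSystem C
  open PredicateAbstraction A
  open Inverse P-finite using (to; from; strictlyInverseʳ)

  α*-resp-≈ : ∀ {S : Pred State 0ℓ} {a b} → b ≈ a → a ∈ α* S → b ∈ α* S
  α*-resp-≈ b≈a (s , s∈ , σ , a≈) = s , s∈ , σ , ≈-trans b≈a a≈

  -- Needed because coding an abstract state as a vector and back returns it only up to `_≈_`. It
  -- holds since `α` is itself defined up to `_≈_`.
  RA^-resp-≈ : ∀ n {a b} → b ≈ a → a ∈ RA^ n → b ∈ RA^ n
  RA^-resp-≈ zero    b≈a a∈        = α*-resp-≈ b≈a a∈
  RA^-resp-≈ (suc n) b≈a (inj₁ a∈) = inj₁ (RA^-resp-≈ n b≈a a∈)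
  RA^-resp-≈ (suc n) b≈a (inj₂ a∈) = inj₂ (α*-resp-≈ b≈a a∈)

  -- The enumeration of `P` represents abstract states, up to `_≈_`, by Boolean vectors, to which
  -- `¬¬-chain-bound` applies.
  encode : AbsState → Vec Bool size
  encode a = tabulate (λ i → a bool (from i))

  decode : Vec Bool size → AbsState
  decode v bool p = lookup v (to p)

  decode∘encode : ∀ a → decode (encode a) ≈ a
  decode∘encode a bool p =
    trans (lookup∘tabulate _ (to p)) (cong (a bool) (strictlyInverseʳ p))

  RA^-¬¬-stationary : ¬ ¬ (∃[ N ] RA^ N ≐ RA^ (suc N))
  RA^-¬¬-stationary ¬stat =
    ¬¬-chain-bound size (λ n v → decode v ∈ RA^ n) (λ _ → inj₁) λ (N , ≤N) →
    -- A bound `N` on the whole chain bounds stage `suc N` in particular: pass to the code of `a`,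
    -- drop to stage `N`, and decode.
    ¬stat (N , inj₁ , λ {a} a∈ →
      RA^-resp-≈ N (≈-sym (decode∘encode a))
        (≤N (suc N) {encode a} (RA^-resp-≈ (suc N) (decode∘encode a) a∈)))

  module _ (N : ℕ) (stat : RA^ (suc N) ⊆ RA^ N) where

    -- Initial states abstract into stage 0, which every later stage contains.
    Q⁰C⊆γRA^ : Q⁰C ⊆ γ (RA^ N)
    Q⁰C⊆γRA^ s∈ σ = chain-mono RA^ (λ _ → inj₁) {n = N} z≤n (_ , s∈ , σ , ≈-refl)

    -- Every abstraction of a successor of `s` lies in `NA (RA^ N)`, hence in stage `suc N`, which
    -- stationarity returns to stage `N`.
    NC-preserves-γRA^ : ∀ {s} → s ∈ γ (RA^ N) → NC s ⊆ γ (RA^ N)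
    NC-preserves-γRA^ s∈ s′∈ σ = stat (inj₂ (_ , (_ , s∈ , s′∈) , σ , ≈-refl))

    RC⊆γRA^ : RC ⊆ γ (RA^ N)
    RC⊆γRA^ (n , r , (σ₀ , r₀≈) , steps , rₙ≈s) =
      -- γ is not evidently closed under ≈, so the invariant ranges over the ≈-class of r i.
      <-weakInduction (λ i → ∀ {s} → s ≈ r i → s ∈ γ (RA^ N))
        (λ s≈ → Q⁰C⊆γRA^ (σ₀ , ≈-trans s≈ r₀≈))
        (λ i ih s≈ → let (σ , r≈) = steps i in
          NC-preserves-γRA^ (ih ≈-refl) (σ , ≈-trans s≈ r≈))
        (fromℕ n) (≈-sym rₙ≈s)

theorem7p4 : (C : ConcreteSystem) (A : PredicateAbstraction C) →
    let open ConcreteSystem C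
        open PredicateAbstraction A
    in (ψ : E 𝒫 bool) →
       (∀ a → a ∈ RA → ⟨ ψ ⟩ a ≡ true) →
       (∀ s → s ∈ RC → s ∈ ∀𝒳 (ψ *))
theorem7p4 C A ψ ψ-holds s s∈RC σ =
  decidable-stable (_ ≟ true) λ ¬eq →
  RA^-¬¬-stationary A λ (N , stat@(_ , ⊇)) →
  -- The abstract state here is `⟪ φ ⟫ (s · σ)`; it lies in `RA` because `s` is in `γ (RA^ N)`.
  ¬eq (trans (eval-subst φ (s · σ) ψ [])
             (ψ-holds _ (N , stat , RC⊆γRA^ A N ⊇ s∈RC σ)))
  where open PredicateAbstraction A
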